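{- Let $i\in\mathbb{Z}^+$ and let $\mathrm{p}_i\mathrm{space}=\mathrm{BFSF}_i(\varnothing)$. Then $\mathrm{BFF}(\mathrm{p}_i\mathrm{space})=\mathrm{p}_i\mathrm{space}$, i.e. $\mathrm{p}_i\mathrm{space}$ is a resource bound.
   Context: Strings are elements of $\{0,1\}^*$, $|w|$ is the length of $w$, $\lambda$ is the empty string. A type-two functional $F$ maps tuples $(\vec f,\vec x)$ of functions $f_1,\dots,f_k:\{0,1\}^*\to\{0,1\}^*$ and strings $x_1,\dots,x_l$ to strings; type-one functions are the case with no function arguments. Strings are identified with natural numbers via the standard enumeration (increasing length, lexicographic within a length, $\lambda\leftrightarrow 0$), and $\le$ on strings is the corresponding order. Operations on functionals. Functional composition: $F(\vec f,\vec x)=H(\vec f,G_1(\vec f,\vec x),\dots,G_l(\vec f,\vec x))$. Expansion: $F(\vec f,\vec g,\vec x,\vec y)=G(\vec f,\vec x)$. Limited recursion on notation (from $G,H,K$): $F(\vec f,\vec x,\lambda)=G(\vec f,\vec x)$; $F(\vec f,\vec x,wb)=H(\vec f,\vec x,wb,F(\vec f,\vec x,w))$ for $b\in\{0,1\}$; and $|F(\vec f,\vec x,w)|\le|K(\vec f,\vec x,w)|$. Bounded recursion (from $G,H,K$): $F(\vec f,\vec x,0)=G(\vec f,\vec x)$; $F(\vec f,\vec x,n+1)=H(\vec f,\vec x,n,F(\vec f,\vec x,n))$; and $F(\vec f,\vec x,n)\le K(\vec f,\vec x,n)$. For a set $X$ of functionals, $\mathrm{BFF}(X)$ is the smallest class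 of functionals containing $X$, all polynomial-time computable type-one functions, and the application functional $\mathrm{Ap}(f,x)=f(x)$, and closed under functional composition, expansion, and limited recursion on notation. A resource bound is a class $\Delta$ of functionals of type at most $2$ that is closed under $\mathrm{BFF}$, i.e. $\mathrm{BFF}(\Delta)=\Delta$. Growth rates: $g_0(n)=2n$ and $g_i(n)=2^{g_{i-1}(\log n)}$ for $i\ge 1$ (so $g_1(n)=n^2$, $g_2(n)=n^{\log n}$); logs are base 2, values are rounded up to integers where an integer is needed, and the finitely many small arguments at which the expression is undefined are assigned arbitrary fixed values. $\mathrm{BFSF}_i(X)$ is the smallest class of functionals containing $X$, all polynomial-time computable type-one functions, the function $x\mapsto 1^{g_i(|x|)}$, and $\mathrm{Ap}$, and closed under functional composition, expansion, and bounded recursion. -}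

module Defs where

open import Algebra.Definitions.RawSemiring using (_^_)
open import Data.Bool.Base using (Bool; true; false; if_then_else_)
open import Data.Fin.Base using (Fin)
open import Data.Integer.Base using (ℤ; +_; -[1+_])
open import Data.List.Base as List using (List; []; _∷_)
import Data.List.Properties as List
open import Data.Maybe.Base using (Maybe; just; nothing)
open import Data.Nat.Base as ℕ using (ℕ; zero; suc)
import Data.Nat.Properties as ℕ
import Data.Nat.Solver as ℕ
open import Data.Product.Base using (Σ-syntax; ∃-syntax; _×_; _,_; proj₁; proj₂)
open import Data.Rational.Base as ℚ using (ℚ; 0ℚ; 1ℚ; ½; ↥_; ↧ₙ_)
open import Data.Sum.Base using (_⊎_)
open import Data.Unit.Base using (⊤)
open import Data.Empty using (⊥)
open import Data.Vec.Base as Vec using (Vec; []; _∷_; _∷ʳ_; _++_)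
open import Function.Bundles using (_⇔_; _↔_; mk↔ₛ′)
open import Level using (0ℓ)
open import Relation.Binary.PropositionalEquality
open import Relation.Unary using (Pred; _≐_)

-- The head of the list is the leftmost symbol, so wb is `w List.∷ʳ b`.
Str : Set
Str = List Bool

∣_∣ : Str → ℕ
∣_∣ = List.length

1^_ : ℕ → Str
1^ n = List.replicate n true

-- Position of w in the length-lexicographic order: the number written
-- 1w in binary, minus 1.  Hence num λ = 0 and
-- num (wb) = 2 · num w + 1 + b.
snocNum : ℕ → Bool → ℕ
snocNum n b = 2 ℕ.* n ℕ.+ (if b then 2 else 1)

num : Str → ℕ
num = List.foldl snocNum 0

-- Successor in the length-lexicographic order, on reversed strings.
incʳ : Str → Str
incʳ []           = false ∷ []
incʳ (false ∷ bs) = true ∷ bs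
incʳ (true  ∷ bs) = false ∷ incʳ bs

strʳ : ℕ → Str
strʳ zero    = []
strʳ (suc n) = incʳ (strʳ n)

str : ℕ → Str
str n = List.reverse (strʳ n)

infix 4 _≤ˢ_

_≤ˢ_ : Str → Str → Set
u ≤ˢ v = num u ℕ.≤ num v

private
  numʳ : Str → ℕ
  numʳ = List.foldr (λ b n → snocNum n b) 0

  numʳ-inc : ∀ w → numʳ (incʳ w) ≡ suc (numʳ w)
  numʳ-inc []          = refl
  numʳ-inc (false ∷ w) = ℕ.+-suc (2 ℕ.* numʳ w) 1
  numʳ-inc (true ∷ w)
    rewrite numʳ-inc w = lemma (numʳ w)
    where
    open ℕ.+-*-Solver
    lemma : ∀ n → 2 ℕ.* suc n ℕ.+ 1 ≡ suc (2 ℕ.* n ℕ.+ 2)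
    lemma = solve 1 (λ n → con 2 :* (con 1 :+ n) :+ con 1
                        := con 1 :+ (con 2 :* n :+ con 2)) refl

  numʳ-strʳ : ∀ n → numʳ (strʳ n) ≡ n
  numʳ-strʳ zero    = refl
  numʳ-strʳ (suc n) = trans (numʳ-inc (strʳ n)) (cong suc (numʳ-strʳ n))

  strʳ-+ : ∀ n → strʳ (suc (n ℕ.+ n)) ≡ false ∷ strʳ n
               × strʳ (suc (suc (n ℕ.+ n))) ≡ true ∷ strʳ n
  strʳ-+ zero = refl , refl
  strʳ-+ (suc n)
    rewrite ℕ.+-suc n n | proj₂ (strʳ-+ n) = refl , refl

  strʳ-numʳ : ∀ w → strʳ (numʳ w) ≡ w
  strʳ-numʳ [] = refl
  strʳ-numʳ (b ∷ w) with numʳ w | strʳ-numʳ w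
  strʳ-numʳ (false ∷ w) | n | refl
    rewrite ℕ.+-identityʳ n | ℕ.+-comm (n ℕ.+ n) 1 = proj₁ (strʳ-+ n)
  strʳ-numʳ (true ∷ w)  | n | refl
    rewrite ℕ.+-identityʳ n | ℕ.+-comm (n ℕ.+ n) 2 = proj₂ (strʳ-+ n)

num-str : ∀ n → num (str n) ≡ n
num-str n = trans (List.reverse-foldl snocNum 0 (strʳ n)) (numʳ-strʳ n)

str-num : ∀ w → str (num w) ≡ w
str-num w = begin
  str (num w)                         ≡⟨ cong (λ v → str (num v)) (List.reverse-involutive w) ⟨
  str (num (List.reverse w′))         ≡⟨ cong str (List.reverse-foldl snocNum 0 w′) ⟩
  List.reverse (strʳ (numʳ w′))       ≡⟨ cong List.reverse (strʳ-numʳ w′) ⟩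
  List.reverse w′                     ≡⟨ List.reverse-involutive w ⟩
  w                                   ∎
  where
  open ≡-Reasoning
  w′ = List.reverse w

enumeration : ℕ ↔ Str
enumeration = mk↔ₛ′ str num str-num num-str

module Turing where

  data Symbol (aux : ℕ) : Set where
    blank : Symbol aux
    bit   : Bool → Symbol aux
    other : Fin aux → Symbol aux

  data Move : Set where
    left stay right : Move

  -- A two-way infinite tape, blank outside the recorded part.
  record Tape (aux : ℕ) : Set where
    constructor tape
    field
      lefts  : List (Symbol aux)   -- nearest to the head first
      head   : Symbol aux
      rights : List (Symbol aux)   -- nearest to the head first

  open Tape public

  module _ {aux : ℕ} where

    fromCells : List (Symbol aux) → Tape aux
    fromCells []       = tape [] blank []
    fromCells (s ∷ ss) = tape [] s ss

    move : Move → Tape aux → Tape aux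
    move stay  t                    = t
    move left  (tape [] h rs)       = tape [] blank (h ∷ rs)
    move left  (tape (l ∷ ls) h rs) = tape ls l (h ∷ rs)
    move right (tape ls h [])       = tape (h ∷ ls) blank []
    move right (tape ls h (r ∷ rs)) = tape (h ∷ ls) r rs

    act : Symbol aux × Move → Tape aux → Tape aux
    act (s , m) (tape ls _ rs) = move m (tape ls s rs)

    leadingBits : List (Symbol aux) → Str
    leadingBits (bit b ∷ ss) = b ∷ leadingBits ss
    leadingBits _            = []

    -- The maximal bit string starting at the head.
    contents : Tape aux → Str
    contents t = leadingBits (head t ∷ rights t)

  -- A deterministic machine with `inputs` input tapes, one output tape
  -- and `work` work tapes, in this order.  It halts where δ is `nothing`.
  record Machine (inputs : ℕ) : Set where
    field
      states aux work : ℕ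

    tapes : ℕ
    tapes = inputs ℕ.+ suc work

    field
      start : Fin states
      δ     : Fin states → Vec (Symbol aux) tapes →
              Maybe (Fin states × Vec (Symbol aux × Move) tapes)

    Config : Set
    Config = Fin states × Vec (Tape aux) tapes

    initial : Vec Str inputs → Config
    initial xs =
      start ,
      Vec.map (λ x → fromCells (List.map bit x)) xs
        ++ Vec.replicate (suc work) (fromCells [])

    step : Config → Maybe Config
    step (q , ts) with δ q (Vec.map head ts)
    ... | nothing       = nothing
    ... | just (q′ , a) = just (q′ , Vec.zipWith act a ts)

    output : Config → Str
    output (_ , ts) = contents (Vec.head (Vec.drop inputs ts))

    -- From c the machine halts after exactly t steps, in c′.
    data HaltsIn : (t : ℕ) (c c′ : Config) → Set where
      halt : ∀ {c} → step c ≡ nothing → HaltsIn 0 c c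
      next : ∀ {t c c′ c″} → step c ≡ just c′ → HaltsIn t c′ c″ →
             HaltsIn (suc t) c c″

-- A polynomial given by its coefficients, constant term first.
Poly : Set
Poly = List ℕ

eval : Poly → ℕ → ℕ
eval p n = List.foldr (λ a r → a ℕ.+ n ℕ.* r) 0 p

PolyTime : ∀ {l} → (Vec Str l → Str) → Set
PolyTime {l} h =
  Σ[ M ∈ Turing.Machine l ] Σ[ p ∈ Poly ]
  let open Turing.Machine M in
  ∀ xs → ∃[ t ] ∃[ c ]
    HaltsIn t (initial xs) c
    × t ℕ.≤ eval p (Vec.sum (Vec.map ∣_∣ xs))
    × output c ≡ h xs

-- Functionals of k functions and l strings; type one is the case k = 0.
Functional : ℕ → ℕ → Set
Functional k l = Vec (Str → Str) k → Vec Str l → Str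

-- The schemes constrain F pointwise, so that they determine F only up to
-- pointwise equality.

Composition : ∀ {k l m} → Functional k m → (Fin m → Functional k l) →
              Functional k l → Set
Composition H G F =
  ∀ fs xs → F fs xs ≡ H fs (Vec.tabulate λ j → G j fs xs)

Expansion : ∀ {k k′ l l′} → Functional k l →
            Functional (k ℕ.+ k′) (l ℕ.+ l′) → Set
Expansion {k} {k′} {l} {l′} G F =
  ∀ (fs : Vec _ k) (gs : Vec _ k′) (xs : Vec _ l) (ys : Vec _ l′) →
  F (fs ++ gs) (xs ++ ys) ≡ G fs xs

record LimitedRecursionOnNotation {k l}
  (G : Functional k l) (H : Functional k (suc (suc l)))
  (K : Functional k (suc l)) (F : Functional k (suc l)) : Set where
  field
    base  : ∀ fs xs → F fs (xs ∷ʳ []) ≡ G fs xs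
    step  : ∀ fs xs w b → let wb = w List.∷ʳ b in
            F fs (xs ∷ʳ wb) ≡ H fs (xs ∷ʳ wb ∷ʳ F fs (xs ∷ʳ w))
    bound : ∀ fs xs w → ∣ F fs (xs ∷ʳ w) ∣ ℕ.≤ ∣ K fs (xs ∷ʳ w) ∣

record BoundedRecursion {k l}
  (G : Functional k l) (H : Functional k (suc (suc l)))
  (K : Functional k (suc l)) (F : Functional k (suc l)) : Set where
  field
    base  : ∀ fs xs → F fs (xs ∷ʳ str 0) ≡ G fs xs
    step  : ∀ fs xs n →
            F fs (xs ∷ʳ str (suc n)) ≡ H fs (xs ∷ʳ str n ∷ʳ F fs (xs ∷ʳ str n))
    bound : ∀ fs xs n → F fs (xs ∷ʳ str n) ≤ˢ K fs (xs ∷ʳ str n)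

Class : Set₁
Class = ∀ k l → Pred (Functional k l) 0ℓ

∅ : Class
∅ _ _ _ = ⊥

infix 4 _≐ᶜ_

_≐ᶜ_ : Class → Class → Set
X ≐ᶜ Y = ∀ k l → X k l ≐ Y k l

data BFF (X : Class) : Class where
  contains : ∀ {k l} {G F : Functional k l} → X k l G →
             (∀ fs xs → F fs xs ≡ G fs xs) → BFF X k l F
  polyTime : ∀ {l} {F : Functional 0 l} → PolyTime (F []) → BFF X 0 l F
  Ap       : ∀ {F : Functional 1 1} →
             (∀ f x → F (f ∷ []) (x ∷ []) ≡ f x) → BFF X 1 1 F
  compose  : ∀ {k l m} {H : Functional k m} {G : Fin m → Functional k l}
             {F : Functional k l} →
             BFF X k m H → (∀ j → BFF X k l (G j)) →
             Composition H G F → BFF X k l F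
  expand   : ∀ {k k′ l l′} {G : Functional k l}
             {F : Functional (k ℕ.+ k′) (l ℕ.+ l′)} →
             BFF X k l G → Expansion {k} {k′} {l} {l′} G F →
             BFF X (k ℕ.+ k′) (l ℕ.+ l′) F
  limRec   : ∀ {k l} {G : Functional k l} {H : Functional k (suc (suc l))}
             {K F : Functional k (suc l)} →
             BFF X k l G → BFF X k (suc (suc l)) H → BFF X k (suc l) K →
             LimitedRecursionOnNotation G H K F → BFF X k (suc l) F

IsResourceBound : Class → Set
IsResourceBound Δ = BFF Δ ≐ᶜ Δ

-- An extended real x is represented by its lower cut { q | q < x }; the
-- empty cut is -∞.
LowerCut : Set₁
LowerCut = Pred ℚ 0ℓ

infixr 8 _^ℚ_

_^ℚ_ : ℚ → ℕ → ℚ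
_^ℚ_ = _^_ ℚ.+-*-rawSemiring

pow2 : ℤ → ℚ
pow2 (+ n)    = (1ℚ ℚ.+ 1ℚ) ^ℚ n
pow2 -[1+ n ] = ½ ^ℚ suc n

infix 4 2^_<_ _<2^_

-- 2^(a/b) < s, as 2^a < s^b with s positive.
2^_<_ : ℚ → ℚ → Set
2^ q < s = 0ℚ ℚ.< s × pow2 (↥ q) ℚ.< s ^ℚ (↧ₙ q)

-- q < 2^(a/b), as q < 0 or q^b < 2^a.
_<2^_ : ℚ → ℚ → Set
q <2^ p = q ℚ.< 0ℚ ⊎ q ^ℚ (↧ₙ p) ℚ.< pow2 (↥ p)

fromℕ : ℕ → LowerCut
fromℕ n q = q ℚ.< + n ℚ./ 1

double : LowerCut → LowerCut
double x q = x (½ ℚ.* q)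

log₂ : LowerCut → LowerCut
log₂ x q = ∃[ s ] x s × 2^ q < s

exp₂ : LowerCut → LowerCut
exp₂ x q = q ℚ.< 0ℚ ⊎ ∃[ p ] x p × q <2^ p

growth : ℕ → LowerCut → LowerCut
growth zero    x = double x
growth (suc i) x = exp₂ (growth i (log₂ x))

-- Every logarithm taken in `growth i x` has a positive argument.
Defined : ℕ → LowerCut → Set
Defined zero    x = ⊤
Defined (suc i) x = x 0ℚ × Defined i (log₂ x)

-- For x ≥ 0: m is the least natural number with x ≤ m.
IsCeiling : LowerCut → ℕ → Set
IsCeiling x m = ∀ k → k ℕ.< m ⇔ x (+ k ℚ./ 1)

-- The growth rate gᵢ on natural numbers: the real value rounded up, and
-- arbitrary where that is undefined.  It is given by its specification,
-- because rounding up a real number is not a computable operation.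
record GrowthRate (i : ℕ) : Set where
  field
    value   : ℕ → ℕ
    rounded : ∀ n → Defined i (fromℕ n) →
              IsCeiling (growth i (fromℕ n)) (value n)

open GrowthRate public

data BFSF {i} (g : GrowthRate i) (X : Class) : Class where
  contains : ∀ {k l} {G F : Functional k l} → X k l G →
             (∀ fs xs → F fs xs ≡ G fs xs) → BFSF g X k l F
  polyTime : ∀ {l} {F : Functional 0 l} → PolyTime (F []) → BFSF g X 0 l F
  grow     : ∀ {F : Functional 0 1} →
             (∀ x → F [] (x ∷ []) ≡ 1^ value g ∣ x ∣) → BFSF g X 0 1 F
  Ap       : ∀ {F : Functional 1 1} →
             (∀ f x → F (f ∷ []) (x ∷ []) ≡ f x) → BFSF g X 1 1 F
  compose  : ∀ {k l m} {H : Functional k m} {G : Fin m → Functional k l}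
             {F : Functional k l} →
             BFSF g X k m H → (∀ j → BFSF g X k l (G j)) →
             Composition H G F → BFSF g X k l F
  expand   : ∀ {k k′ l l′} {G : Functional k l}
             {F : Functional (k ℕ.+ k′) (l ℕ.+ l′)} →
             BFSF g X k l G → Expansion {k} {k′} {l} {l′} G F →
             BFSF g X (k ℕ.+ k′) (l ℕ.+ l′) F
  boundRec : ∀ {k l} {G : Functional k l} {H : Functional k (suc (suc l))}
             {K F : Functional k (suc l)} →
             BFSF g X k l G → BFSF g X k (suc (suc l)) H →
             BFSF g X k (suc l) K →
             BoundedRecursion G H K F → BFSF g X k (suc l) F

pSpace : ∀ {i} → GrowthRate i → Class
pSpace g = BFSF g ∅

{-# OPTIONS --safe #-}

-- Limited recursion on notation reduces to bounded recursion: while n runs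
-- through all numbers below num w, the nonempty prefixes of w occur among the
-- strings str n in order of increasing length.  Bounded recursion on n can
-- therefore carry the value of F at the longest prefix of w met so far, and
-- apply H exactly when str n is a nonempty prefix of w; one more such step at
-- w itself yields F at w.  A bound for the recursion is 1^∣K∣ at the same
-- prefix, because ∣u∣ ≤ ∣v∣ implies u ≤ 1^∣v∣.

module Submission where

open import Data.Bool.Base using (Bool; true; false; if_then_else_)
open import Data.Bool.Properties using (_≟_)
open import Data.Empty using (⊥-elim)
open import Data.Fin.Base as Fin using (Fin; zero; suc; inject₁; _↑ˡ_; _↑ʳ_)
open import Data.Fin.Patterns using (0F; 1F; 2F; 3F; 4F; 5F)
open import Data.List.Base as List using ([]; _∷_; _ʳ++_)
import Data.List.Properties as List
open import Data.Maybe.Base as Maybe using (Maybe; just; nothing)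
open import Data.Nat.Base as ℕ using (ℕ; zero; suc; NonZero)
import Data.Nat.Properties as ℕ
open import Data.Nat.Solver using (module +-*-Solver)
open import Data.Product.Base using (∃-syntax; _×_; _,_; proj₁; proj₂)
open import Data.Sum.Base using (_⊎_; inj₁; inj₂)
open import Data.Vec.Base as Vec using (Vec; []; _∷_; _∷ʳ_; _++_)
import Data.Vec.Properties as Vec
open import Function.Base using (_∘_; const)
open import Relation.Nullary using (yes; no)
open import Relation.Binary.PropositionalEquality
open import Defs

private
  variable
    k l m : ℕ

-- Selection by flags and prefix tests.

select : Str → Str → Str → Str
select []      a b = b
select (_ ∷ _) a b = a

-- Flags are strings that are nonempty when true.
prefixFlag : Str → Str → Str
prefixFlag []      w       = true ∷ []
prefixFlag (b ∷ u) []      = []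
prefixFlag (b ∷ u) (c ∷ w) with b ≟ c
... | yes _ = prefixFlag u w
... | no  _ = []

nonemptyPrefixFlag : Str → Str → Str
nonemptyPrefixFlag []      w = []
nonemptyPrefixFlag (b ∷ u) w = prefixFlag (b ∷ u) w

prefixFlag-++ : ∀ u r → prefixFlag u (u List.++ r) ≡ true ∷ []
prefixFlag-++ []      r = refl
prefixFlag-++ (b ∷ u) r with b ≟ b
... | yes _  = prefixFlag-++ u r
... | no b≢b = ⊥-elim (b≢b refl)

prefixFlag-sound : ∀ u w {c cs} → prefixFlag u w ≡ c ∷ cs → ∃[ r ] u List.++ r ≡ w
prefixFlag-sound []      w       _  = w , refl
prefixFlag-sound (b ∷ u) (c ∷ w) eq with b ≟ c
... | yes refl = let r , e = prefixFlag-sound u w eq in r , cong (b ∷_) e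

-- The prefix is exposed as `v List.∷ʳ b`, the only shape to which the step equation of limited
-- recursion applies.
nonemptyPrefixFlag-sound : ∀ u w {c cs} → nonemptyPrefixFlag u w ≡ c ∷ cs →
  ∃[ v ] ∃[ b ] ∃[ r ] u ≡ v List.∷ʳ b × u List.++ r ≡ w
nonemptyPrefixFlag-sound u w eq with List.initLast u
... | v List.∷ʳ′ b with v
...   | []     = let r , e = prefixFlag-sound (b ∷ []) w eq in [] , b , r , refl , e
...   | c ∷ v′ = let r , e = prefixFlag-sound (c ∷ v′ List.∷ʳ b) w eq in c ∷ v′ , b , r , refl , e

prefixes-comparable : ∀ (u v : Str) {r s} → u List.++ r ≡ v List.++ s →
  (∃[ t ] u ≡ v List.++ t) ⊎ (∃[ t ] v ≡ u List.++ t)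
prefixes-comparable u       []      eq = inj₁ (u , refl)
prefixes-comparable []      (c ∷ v) eq = inj₂ (c ∷ v , refl)
prefixes-comparable (b ∷ u) (c ∷ v) eq with List.∷-injective eq
... | refl , eq′ with prefixes-comparable u v eq′
...   | inj₁ (t , e)     = inj₁ (t , cong (b ∷_) e)
...   | inj₂ (t , e) = inj₂ (t , cong (b ∷_) e)

-- The numbering of strings and its order.

-- The numbering is bijective base 2, with digits 1 and 2; as no digit is 0, the increase is strict
-- even at `n = 0`.
snocNum-increasing : ∀ n b → n ℕ.< snocNum n b
snocNum-increasing n b = ℕ.≤-trans (ℕ.≤-reflexive (ℕ.+-comm 1 n)) (ℕ.+-mono-≤ (ℕ.m≤m+n n _) (digit b))
  where
  digit : ∀ b → 1 ℕ.≤ (if b then 2 else 1)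
  digit true  = ℕ.s≤s ℕ.z≤n
  digit false = ℕ.s≤s ℕ.z≤n

snocNum-mono : ∀ {m n} b → m ℕ.≤ n → snocNum m b ℕ.≤ snocNum n true
snocNum-mono true  m≤n = ℕ.+-mono-≤ (ℕ.*-monoʳ-≤ 2 m≤n) ℕ.≤-refl
snocNum-mono false m≤n = ℕ.+-mono-≤ (ℕ.*-monoʳ-≤ 2 m≤n) (ℕ.s≤s ℕ.z≤n)

foldl-snocNum-increasing : ∀ n w → n ℕ.≤ List.foldl snocNum n w
foldl-snocNum-increasing n []      = ℕ.≤-refl
foldl-snocNum-increasing n (b ∷ w) =
  ℕ.≤-trans (ℕ.<⇒≤ (snocNum-increasing n b)) (foldl-snocNum-increasing (snocNum n b) w)

num-++ : ∀ v t → num v ℕ.≤ num (v List.++ t)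
num-++ v t rewrite List.foldl-++ snocNum 0 v t = foldl-snocNum-increasing (num v) t

num-∷ʳ : ∀ v b → num v ℕ.< num (v List.∷ʳ b)
num-∷ʳ v b rewrite List.foldl-∷ʳ snocNum 0 b v = snocNum-increasing (num v) b

-- Two accumulators are needed because `foldl` changes them on both sides at once. When `w` is
-- exhausted, the remaining ones only enlarge the right-hand side.
foldl-snocNum-≤ : ∀ {m n} w k → m ℕ.≤ n → ∣ w ∣ ℕ.≤ k →
  List.foldl snocNum m w ℕ.≤ List.foldl snocNum n (1^ k)
foldl-snocNum-≤ []      k m≤n _ = ℕ.≤-trans m≤n (foldl-snocNum-increasing _ (1^ k))
foldl-snocNum-≤ (b ∷ w) (suc k) m≤n (ℕ.s≤s le) = foldl-snocNum-≤ w k (snocNum-mono b m≤n) le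

≤ˢ-1^ : ∀ w {k} → ∣ w ∣ ℕ.≤ k → w ≤ˢ 1^ k
≤ˢ-1^ w = foldl-snocNum-≤ w _ ℕ.z≤n

-- The longest prefix met so far.

-- The bound is exclusive, except that the empty prefix is the default even at 0. Later prefixes are
-- longer, so overwriting keeps the longest.
longestPrefixBelow : Str → ℕ → Str
longestPrefixBelow w zero    = []
longestPrefixBelow w (suc n) =
  select (nonemptyPrefixFlag (str n) w) (str n) (longestPrefixBelow w n)

-- This lets the recursion counter itself serve as the bound when this function is defined by
-- bounded recursion.
longestPrefixBelow-≤ : ∀ w n → num (longestPrefixBelow w n) ℕ.≤ n
longestPrefixBelow-≤ w zero = ℕ.z≤n
longestPrefixBelow-≤ w (suc n) with nonemptyPrefixFlag (str n) w
... | []    = ℕ.m≤n⇒m≤1+n (longestPrefixBelow-≤ w n)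
... | _ ∷ _ = ℕ.≤-trans (ℕ.≤-reflexive (num-str n)) (ℕ.n≤1+n n)

-- Prefixes of one string are comparable: either `u` extends `v List.∷ʳ b`, or it is a proper prefix
-- of it, hence a prefix of `v`, against `num v < num u`.
no-prefix-between : ∀ v b u {r s} →
  u List.++ r ≡ (v List.∷ʳ b) List.++ s → num v ℕ.< num u → num (v List.∷ʳ b) ℕ.≤ num u
no-prefix-between v b u eq v<u with prefixes-comparable u (v List.∷ʳ b) eq
... | inj₁ (t , refl) = num-++ (v List.∷ʳ b) t
... | inj₂ (t , e) with List.initLast t
...   | [] rewrite List.++-identityʳ u = ℕ.≤-reflexive (cong num e)
...   | t′ List.∷ʳ′ d
  with refl ← List.∷ʳ-injectiveˡ v (u List.++ t′)
                (trans e (sym (List.++-assoc u t′ (d ∷ []))))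
  = ⊥-elim (ℕ.<⇒≱ v<u (num-++ u t′))

longestPrefixBelow-prefix : ∀ v r → longestPrefixBelow (v List.++ r) (suc (num v)) ≡ v
longestPrefixBelow-prefix v r rewrite str-num v with v
-- The empty prefix raises no flag; here the default value at 0 is the right one.
... | []     = refl
... | b ∷ v′ rewrite prefixFlag-++ (b ∷ v′) r = refl

-- Induction on `n`: just past `num v` the last string tested is `v`, and from there up to
-- `num (v List.∷ʳ b)` no further prefix occurs.
longestPrefixBelow-parent : ∀ v b r n →
  num v ℕ.< n → n ℕ.≤ num (v List.∷ʳ b) →
  longestPrefixBelow ((v List.∷ʳ b) List.++ r) n ≡ v
longestPrefixBelow-parent v b r (suc n) (ℕ.s≤s v≤n) n<vb
  with ℕ.m≤n⇒m<n∨m≡n v≤n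
... | inj₂ refl rewrite List.++-assoc v (b ∷ []) r = longestPrefixBelow-prefix v (b ∷ r)
... | inj₁ v<n with nonemptyPrefixFlag (str n) ((v List.∷ʳ b) List.++ r) in eq
...   | []    = longestPrefixBelow-parent v b r n v<n (ℕ.<⇒≤ n<vb)
...   | _ ∷ _ =
  let _ , _ , _ , _ , e = nonemptyPrefixFlag-sound (str n) _ eq
  in ⊥-elim (ℕ.<⇒≱ n<vb (subst (num (v List.∷ʳ b) ℕ.≤_) (num-str n)
       (no-prefix-between v b (str n) e (subst (num v ℕ.<_) (sym (num-str n)) v<n))))

longestPrefixBelow-self : ∀ w → longestPrefixBelow w (suc (num w)) ≡ w
longestPrefixBelow-self w =
  subst (λ v → longestPrefixBelow v (suc (num w)) ≡ w) (List.++-identityʳ w)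
    (longestPrefixBelow-prefix w [])

-- Machine runs and tapes that hold bit strings.

open Turing

-- The shape of an input tape throughout a scan to the right; the blank under the head marks the end
-- of the bits.
scanning : List.List (Symbol 0) → Str → Tape 0
scanning ls []      = tape ls blank []
scanning ls (b ∷ w) = tape ls (bit b) (List.map bit w)

fromCells-bits : ∀ w → fromCells (List.map bit w) ≡ scanning [] w
fromCells-bits []      = refl
fromCells-bits (_ ∷ _) = refl

right-scanning : ∀ ls b w →
  move right (tape ls (bit b) (List.map bit w)) ≡ scanning (bit b ∷ ls) w
right-scanning ls b []      = refl
right-scanning ls b (_ ∷ _) = refl

module Run (M : Machine l) where
  open Machine M public

  Produces : ℕ → Config → Str → Set
  Produces t c s = ∃[ c′ ] HaltsIn t c c′ × output c′ ≡ s

  produces-next : ∀ {t c c′ s} → step c ≡ just c′ → Produces t c′ s → Produces (suc t) c s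
  produces-next e (c″ , h , o) = c″ , next e h , o

  output-lookup : ∀ q ts → output (q , ts) ≡ contents (Vec.lookup ts (l ↑ʳ zero))
  output-lookup q ts = cong contents (go l ts)
    where
    go : ∀ l {n} {A : Set} (ts : Vec A (l ℕ.+ suc n)) →
         Vec.head (Vec.drop l ts) ≡ Vec.lookup ts (l ↑ʳ zero)
    go zero    (_ ∷ _)  = refl
    go (suc l) (_ ∷ ts) = go l ts

-- A linear-time machine for selection with a symbolwise map.

-- Copying runs backwards, so that the output head ends one cell to the left
-- of the output.
module Selecting {l} (c a b : Fin l) (f : Bool → Symbol 0) where

  -- State 0 branches on `c`; states 1 and 2 run to the right end of `a` or `b`; states 3 and 4 copy
  -- on the way back; state 5 halts.
  watched : Fin 6 → Fin l
  watched 0F = c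
  watched 1F = a
  watched 2F = b
  watched 3F = a
  watched 4F = b
  watched 5F = c

  Action : Set
  Action = Fin 6 × Move × (Symbol 0 × Move)

  choosing : Symbol 0 → Maybe Action
  choosing blank   = just (2F , stay , blank , stay)
  choosing (bit _) = just (1F , stay , blank , stay)

  seeking copying : Fin 6 → Fin 6 → Symbol 0 → Maybe Action
  seeking q q′ blank   = just (q′ , left  , blank , stay)
  seeking q q′ (bit _) = just (q  , right , blank , stay)
  copying q q′ blank   = just (q′ , stay , blank , right)
  copying q q′ (bit b) = just (q  , left , f b   , left)

  action : Fin 6 → Symbol 0 → Maybe Action
  action 0F = choosing
  action 1F = seeking 1F 3F
  action 2F = seeking 2F 4F
  action 3F = copying 3F 5F
  action 4F = copying 4F 5F
  action 5F = const nothing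

  -- All input heads move alike and write back what they read, so a single `Move` describes what
  -- happens to every input tape.
  acts : Move → Symbol 0 × Move → Vec (Symbol 0) (l ℕ.+ 1) → Vec (Symbol 0 × Move) (l ℕ.+ 1)
  acts m o hs = Vec.tabulate (λ i → Vec.lookup hs (i ↑ˡ 1) , m) ++ o ∷ []

  machine : Machine l
  machine = record
    { states = 6
    ; aux    = 0
    ; work   = 0
    ; start  = 0F
    ; δ      = λ q hs → Maybe.map (λ (q′ , m , o) → q′ , acts m o hs)
                          (action q (Vec.lookup hs (watched q ↑ˡ 1)))
    }

  open Run machine

  Tapes : Set
  Tapes = Vec (Tape 0) (l ℕ.+ 1)

  input : Tapes → Fin l → Tape 0
  input ts i = Vec.lookup ts (i ↑ˡ 1)

  out : Tapes → Tape 0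
  out ts = Vec.lookup ts (l ↑ʳ zero)

  advance : Move → Symbol 0 × Move → Tapes → Tapes
  advance m o ts = Vec.zipWith act (acts m o (Vec.map head ts)) ts

  input-advance : ∀ m o ts i → input (advance m o ts) i ≡ move m (input ts i)
  input-advance m o ts i
    rewrite Vec.lookup-zipWith act (i ↑ˡ 1) (acts m o (Vec.map head ts)) ts
          | Vec.lookup-++ˡ (Vec.tabulate (λ i → Vec.lookup (Vec.map head ts) (i ↑ˡ 1) , m)) (o ∷ []) i
          | Vec.lookup∘tabulate (λ i → Vec.lookup (Vec.map head ts) (i ↑ˡ 1) , m) i
          | Vec.lookup-map (i ↑ˡ 1) head ts = refl

  out-advance : ∀ m o ts → out (advance m o ts) ≡ act o (out ts)
  out-advance m o ts
    rewrite Vec.lookup-zipWith act (l ↑ʳ zero) (acts m o (Vec.map head ts)) ts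
          | Vec.lookup-++ʳ (Vec.tabulate (λ i → Vec.lookup (Vec.map head ts) (i ↑ˡ 1) , m)) (o ∷ []) zero
          = refl

  step-action : ∀ q ts {s q′ m o} → head (input ts (watched q)) ≡ s →
    action q s ≡ just (q′ , m , o) → step (q , ts) ≡ just (q′ , advance m o ts)
  step-action q ts refl e
    rewrite Vec.lookup-map (watched q ↑ˡ 1) head ts | e = refl

  contents-right : ∀ os → contents (move right (tape [] blank os)) ≡ leadingBits {0} os
  contents-right []      = refl
  contents-right (_ ∷ _) = refl

  -- `ls` holds the bits still to be copied, last bit first. Writing the position as a `move left`
  -- covers the blank before the input too. The extra step puts the output head onto the output.
  copies : ∀ q → action q ≡ copying q 5F → ∀ ls {s rs os} ts →
    input ts (watched q) ≡ move left (tape (List.map bit ls) s rs) →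
    out ts ≡ tape [] blank os →
    Produces (suc ∣ ls ∣) (q , ts) (leadingBits (List.map f ls ʳ++ os))
  copies q is [] {os = os} ts ein eout =
    produces-next {t = 0} (step-action q ts (cong head ein) (cong (λ α → α blank) is))
      (_ , halt refl , (begin
        output (5F , ts′)                          ≡⟨ output-lookup 5F ts′ ⟩
        contents (out ts′)                         ≡⟨ cong contents (out-advance stay (blank , right) ts) ⟩
        contents (act (blank , right) (out ts))    ≡⟨ cong (contents ∘ act (blank , right)) eout ⟩
        contents (move right (tape [] blank os))   ≡⟨ contents-right os ⟩
        leadingBits os                             ∎))
    where
    open ≡-Reasoning
    ts′ = advance stay (blank , right) ts
  copies q is (b ∷ ls) ts ein eout =
    produces-next (step-action q ts (cong head ein) (cong (λ α → α (bit b)) is))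
      (copies q is ls (advance left (f b , left) ts)
        (trans (input-advance left _ ts (watched q)) (cong (move left) ein))
        (trans (out-advance left _ ts) (cong (act (f b , left)) eout)))

  -- `ls` collects the bits passed. The time is one step per bit of `rs`, one to turn round, and
  -- then that of `copies`.
  seeks : ∀ q q′ → action q ≡ seeking q q′ → action q′ ≡ copying q′ 5F → watched q′ ≡ watched q →
    ∀ ls rs ts → input ts (watched q) ≡ scanning (List.map bit ls) rs →
    out ts ≡ tape [] blank [] →
    Produces (∣ rs ∣ ℕ.+ suc (suc ∣ rs ʳ++ ls ∣)) (q , ts)
      (leadingBits (List.map f (rs ʳ++ ls) ʳ++ []))
  seeks q q′ is is′ same ls [] ts ein eout =
    produces-next (step-action q ts (cong head ein) (cong (λ α → α blank) is))
      (copies q′ is′ ls (advance left (blank , stay) ts)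
        (trans (input-advance left _ ts (watched q′))
               (cong (move left) (trans (cong (input ts) same) ein)))
        (trans (out-advance left _ ts) (cong (act (blank , stay)) eout)))
  seeks q q′ is is′ same ls (b ∷ rs) ts ein eout =
    produces-next (step-action q ts (cong head ein) (cong (λ α → α (bit b)) is))
      (seeks q q′ is is′ same (b ∷ ls) rs (advance right (blank , stay) ts)
        (trans (input-advance right _ ts (watched q))
               (trans (cong (move right) ein) (right-scanning (List.map bit ls) b rs)))
        (trans (out-advance right _ ts) (cong (act (blank , stay)) eout)))

  selected : Vec Str l → Str
  selected xs = select (Vec.lookup xs c) (Vec.lookup xs a) (Vec.lookup xs b)

  chooses : ∀ xs ts → (∀ i → input ts i ≡ scanning [] (Vec.lookup xs i)) →
    out ts ≡ tape [] blank [] →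
    Produces (suc (∣ selected xs ∣ ℕ.+ suc (suc ∣ selected xs ʳ++ [] ∣))) (0F , ts)
      (leadingBits (List.map f (selected xs ʳ++ []) ʳ++ []))
  chooses xs ts ein eout with Vec.lookup xs c in eq
  ... | [] =
    produces-next (step-action 0F ts (cong head (trans (ein c) (cong (scanning []) eq))) refl)
      (seeks 2F 4F refl refl refl [] _ _
        (trans (input-advance stay _ ts b) (ein b))
        (trans (out-advance stay _ ts) (cong (act (blank , stay)) eout)))
  ... | _ ∷ _ =
    produces-next (step-action 0F ts (cong head (trans (ein c) (cong (scanning []) eq))) refl)
      (seeks 1F 3F refl refl refl [] _ _
        (trans (input-advance stay _ ts a) (ein a))
        (trans (out-advance stay _ ts) (cong (act (blank , stay)) eout)))

  length≤sum : ∀ {n} (xs : Vec Str n) i → ∣ Vec.lookup xs i ∣ ℕ.≤ Vec.sum (Vec.map ∣_∣ xs)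
  length≤sum (x ∷ xs) zero    = ℕ.m≤m+n _ _
  length≤sum (x ∷ xs) (suc i) = ℕ.≤-trans (length≤sum xs i) (ℕ.m≤n+m _ _)

  selected≤sum : ∀ xs → ∣ selected xs ∣ ℕ.≤ Vec.sum (Vec.map ∣_∣ xs)
  selected≤sum xs with Vec.lookup xs c
  ... | []    = length≤sum xs b
  ... | _ ∷ _ = length≤sum xs a

  -- Seeking reverses the string and copying reverses it back.
  copied : ∀ (x : Str) → List.map f (x ʳ++ []) ʳ++ [] ≡ List.map f x
  copied x = begin
    List.map f (x ʳ++ []) ʳ++ []   ≡⟨ cong (_ʳ++ []) (List.map-ʳ++ f x) ⟩
    (List.map f x ʳ++ []) ʳ++ []   ≡⟨ List.ʳ++-ʳ++ (List.map f x) ⟩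
    List.map f x List.++ []        ≡⟨ List.++-identityʳ _ ⟩
    List.map f x                   ∎
    where open ≡-Reasoning

  -- The choice of `f` makes one machine serve three ends: `bit` copies, `const (bit true)` gives
  -- the length in unary, and `const blank` gives the empty string.
  select-polyTime : PolyTime (λ xs → leadingBits (List.map f (selected xs)))
  -- The time is 2n + 3 for a selected string of length n: one branching step, n + 1 for seeking, n
  -- + 1 for copying.
  select-polyTime = machine , 3 ∷ 2 ∷ [] , run
    where
    run : ∀ xs → ∃[ t ] ∃[ c′ ] HaltsIn t (initial xs) c′ ×
          t ℕ.≤ eval (3 ∷ 2 ∷ []) (Vec.sum (Vec.map ∣_∣ xs)) ×
          output c′ ≡ leadingBits (List.map f (selected xs))
    run xs =
      let c′ , h , o = chooses xs (proj₂ (initial xs)) ein (Vec.lookup-++ʳ ins _ zero)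
      in _ , c′ , h , time , trans o (cong leadingBits (copied (selected xs)))
      where
      ins = Vec.map (λ x → fromCells (List.map bit x)) xs
      ein : ∀ i → input (proj₂ (initial xs)) i ≡ scanning [] (Vec.lookup xs i)
      ein i = begin
        input (proj₂ (initial xs)) i                  ≡⟨ Vec.lookup-++ˡ ins _ i ⟩
        Vec.lookup ins i                              ≡⟨ Vec.lookup-map i _ xs ⟩
        fromCells (List.map bit (Vec.lookup xs i))    ≡⟨ fromCells-bits (Vec.lookup xs i) ⟩
        scanning [] (Vec.lookup xs i)                 ∎
        where open ≡-Reasoning
      n = ∣ selected xs ∣
      N = Vec.sum (Vec.map ∣_∣ xs)
      time : suc (n ℕ.+ suc (suc ∣ selected xs ʳ++ [] ∣)) ℕ.≤ eval (3 ∷ 2 ∷ []) N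
      time = begin
        suc (n ℕ.+ suc (suc ∣ selected xs ʳ++ [] ∣))
          ≡⟨ cong (λ j → suc (n ℕ.+ suc (suc j))) (List.length-ʳ++ (selected xs)) ⟩
        suc (n ℕ.+ suc (suc (n ℕ.+ 0)))   ≡⟨ solve 1 (λ n → con 1 :+ (n :+ (con 2 :+ (n :+ con 0)))
                                                       := con 3 :+ n :* (con 2 :+ n :* con 0)) refl n ⟩
        3 ℕ.+ n ℕ.* (2 ℕ.+ n ℕ.* 0)
          ≤⟨ ℕ.+-monoʳ-≤ 3 (ℕ.*-mono-≤ (selected≤sum xs) (ℕ.+-monoʳ-≤ 2 (ℕ.*-monoˡ-≤ 0 (selected≤sum xs)))) ⟩
        eval (3 ∷ 2 ∷ []) N               ∎
        where
        open ℕ.≤-Reasoning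
        open +-*-Solver

open Selecting using (select-polyTime)

-- A linear-time machine for the prefix test.

module Testing where

  -- Rejecting is halting with the output tape still blank, which reads as the empty flag; `true` is
  -- printed once the first string is exhausted.
  comparing : Symbol 0 → Symbol 0 → Maybe (Fin 3 × Vec (Symbol 0 × Move) 3)
  comparing blank   s = just (2F , (blank , stay) ∷ (s , stay) ∷ (bit true , stay) ∷ [])
  comparing (bit b) blank = nothing
  comparing (bit b) (bit c) with b ≟ c
  ... | yes _ = just (1F , (bit b , right) ∷ (bit c , right) ∷ (blank , stay) ∷ [])
  ... | no  _ = nothing

  -- A separate start state rejects the empty string, which the comparison would accept.
  starting : Symbol 0 → Symbol 0 → Maybe (Fin 3 × Vec (Symbol 0 × Move) 3)
  starting blank   s = nothing
  starting (bit b) s = just (1F , (bit b , stay) ∷ (s , stay) ∷ (blank , stay) ∷ [])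

  transition : Fin 3 → Vec (Symbol 0) 3 → Maybe (Fin 3 × Vec (Symbol 0 × Move) 3)
  transition 0F (s ∷ s′ ∷ _) = starting s s′
  transition 1F (s ∷ s′ ∷ _) = comparing s s′
  transition 2F _            = nothing

  machine : Machine 2
  machine = record { states = 3 ; aux = 0 ; work = 0 ; start = 0F ; δ = transition }

  open Run machine

  empty : Tape 0
  empty = tape [] blank []

  compares : ∀ ls ls′ u w → ∃[ t ] t ℕ.≤ suc ∣ u ∣ ×
    Produces t (1F , scanning ls u ∷ scanning ls′ w ∷ empty ∷ []) (prefixFlag u w)
  compares ls ls′ []      []      = 1 , ℕ.≤-refl , _ , next refl (halt refl) , refl
  compares ls ls′ []      (c ∷ w) = 1 , ℕ.≤-refl , _ , next refl (halt refl) , refl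
  compares ls ls′ (b ∷ u) []      = 0 , ℕ.z≤n , _ , halt refl , refl
  compares ls ls′ (b ∷ u) (c ∷ w) with b ≟ c in eq
  ... | no  _ = 0 , ℕ.z≤n , _ , halt stuck , refl
    where
    stuck : step (1F , scanning ls (b ∷ u) ∷ scanning ls′ (c ∷ w) ∷ empty ∷ []) ≡ nothing
    stuck rewrite eq = refl
  ... | yes _ =
    let t , t≤ , p = compares (bit b ∷ ls) (bit c ∷ ls′) u w
    in suc t , ℕ.s≤s t≤ , produces-next moves p
    where
    moves : step (1F , scanning ls (b ∷ u) ∷ scanning ls′ (c ∷ w) ∷ empty ∷ []) ≡
            just (1F , scanning (bit b ∷ ls) u ∷ scanning (bit c ∷ ls′) w ∷ empty ∷ [])
    moves rewrite eq | right-scanning ls b u | right-scanning ls′ c w = refl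

  tests : ∀ u w → ∃[ t ] t ℕ.≤ 2 ℕ.+ ∣ u ∣ ×
    Produces t (0F , scanning [] u ∷ scanning [] w ∷ empty ∷ []) (nonemptyPrefixFlag u w)
  tests [] w = 0 , ℕ.z≤n , _ , halt refl , refl
  tests (b ∷ u) w =
    let t , t≤ , p = compares [] [] (b ∷ u) w
    in suc t , ℕ.s≤s t≤ , produces-next moves p
    where
    act-stay : ∀ (t : Tape 0) → act (head t , stay) t ≡ t
    act-stay (tape _ _ _) = refl
    moves : step (0F , scanning [] (b ∷ u) ∷ scanning [] w ∷ empty ∷ []) ≡
            just (1F , scanning [] (b ∷ u) ∷ scanning [] w ∷ empty ∷ [])
    moves rewrite act-stay (scanning [] w) = refl

  nonemptyPrefix-polyTime :
    PolyTime (λ (xs : Vec Str 2) → nonemptyPrefixFlag (Vec.head xs) (Vec.last xs))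
  -- One starting step, at most one step per bit of the first string, and one step to print the
  -- flag.
  nonemptyPrefix-polyTime = machine , 2 ∷ 1 ∷ [] , run
    where
    run : ∀ xs → ∃[ t ] ∃[ c′ ] HaltsIn t (initial xs) c′ ×
          t ℕ.≤ eval (2 ∷ 1 ∷ []) (Vec.sum (Vec.map ∣_∣ xs)) ×
          output c′ ≡ nonemptyPrefixFlag (Vec.head xs) (Vec.last xs)
    run (u ∷ w ∷ []) rewrite fromCells-bits u | fromCells-bits w =
      let t , t≤ , c′ , h , o = tests u w
      in t , c′ , h , ℕ.≤-trans t≤ (ℕ.+-monoʳ-≤ 2 time) , o
      where
      N = ∣ u ∣ ℕ.+ (∣ w ∣ ℕ.+ 0)
      time : ∣ u ∣ ℕ.≤ N ℕ.* (1 ℕ.+ N ℕ.* 0)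
      time = ℕ.≤-trans (ℕ.m≤m+n _ _) (ℕ.m≤m*n N (1 ℕ.+ N ℕ.* 0))

open Testing using (nonemptyPrefix-polyTime)

-- Vector access from the right end, and the effect of each symbolwise map.

init-lookup : ∀ {A : Set} (ys : Vec A (suc m)) j →
  Vec.lookup (Vec.init ys) j ≡ Vec.lookup ys (inject₁ j)
init-lookup (y ∷ z ∷ ys) zero    = refl
init-lookup (y ∷ z ∷ ys) (suc j) = init-lookup (z ∷ ys) j

tail-lookup : ∀ {A : Set} (ys : Vec A (suc m)) {j} →
  Vec.lookup (Vec.tail ys) j ≡ Vec.lookup ys (suc j)
tail-lookup (_ ∷ _) = refl

last-lookup : ∀ {A : Set} (ys : Vec A (suc m)) → Vec.last ys ≡ Vec.lookup ys (Fin.fromℕ m)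
last-lookup (y ∷ [])     = refl
last-lookup (y ∷ z ∷ ys) = last-lookup (z ∷ ys)

init∷ʳlast : ∀ {A : Set} (ys : Vec A (suc m)) → Vec.init ys ∷ʳ Vec.last ys ≡ ys
init∷ʳlast (y ∷ [])     = refl
init∷ʳlast (y ∷ z ∷ ys) = cong (y ∷_) (init∷ʳlast (z ∷ ys))

leadingBits-map-bit : ∀ x → leadingBits {0} (List.map bit x) ≡ x
leadingBits-map-bit []      = refl
leadingBits-map-bit (b ∷ x) = cong (b ∷_) (leadingBits-map-bit x)

leadingBits-map-true : ∀ (x : Str) →
  leadingBits {0} (List.map (const (bit true)) x) ≡ 1^ ∣ x ∣
leadingBits-map-true []      = refl
leadingBits-map-true (b ∷ x) = cong (true ∷_) (leadingBits-map-true x)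

leadingBits-map-blank : ∀ (x : Str) →
  leadingBits {0} (List.map (const blank) x) ≡ []
leadingBits-map-blank []      = refl
leadingBits-map-blank (b ∷ x) = refl

select-idem : ∀ c a → select c a a ≡ a
select-idem []      a = refl
select-idem (_ ∷ _) a = refl

-- Closure properties of the bounded-recursion class.

module Closure {i} {g : GrowthRate i} {X : Class} where

  In : Functional k l → Set
  In {k} {l} = BFSF g X k l

  -- Expansion adds `k` functions and no strings, which gives arity `l + 0`.
  lift-polyTime : ∀ {h : Vec Str l → Str} {F : Functional k l} → PolyTime h →
    (∀ fs xs → F fs xs ≡ h xs) → In F
  lift-polyTime {l} {k} {h} p F≗h =
    -- Generalising the arity to `m` allows the equation with `l + 0` to be matched with `refl`.
    go (ℕ.+-identityʳ l) λ fs xs →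
      trans (F≗h fs _) (cong h (Vec.++-identityʳ-eqFree xs))
    where
    go : ∀ (e : l ℕ.+ 0 ≡ m) {H : Functional k m} →
         (∀ fs xs → H fs (Vec.cast e (xs ++ [])) ≡ h xs) → In H
    go refl {H} eq = expand {k = 0} {k′ = k} {l′ = 0} (polyTime {F = λ _ → h} p)
      λ { [] gs xs [] → trans (cong (H gs) (sym (Vec.cast-is-id refl _))) (eq gs xs) }

  -- A projection is a selection whose condition and branches are the same argument.
  mapped-project : ∀ (f : Bool → Symbol 0) (j : Fin l) {F : Functional k l} →
    (∀ fs xs → F fs xs ≡ leadingBits (List.map f (Vec.lookup xs j))) → In F
  mapped-project f j eq = lift-polyTime (select-polyTime j j j f) λ fs xs →
    trans (eq fs xs) (cong (leadingBits ∘ List.map f)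
      (sym (select-idem (Vec.lookup xs j) (Vec.lookup xs j))))

  project : ∀ (j : Fin l) → In {k} (λ _ xs → Vec.lookup xs j)
  project j = mapped-project bit j λ _ xs → sym (leadingBits-map-bit (Vec.lookup xs j))

  -- Composing with projections gives back `G` only up to pointwise equality, so any `F` pointwise
  -- equal to it is reached without extensionality.
  respects-≗ : ∀ {F G : Functional k l} → (∀ fs xs → F fs xs ≡ G fs xs) → In G → In F
  respects-≗ {G = G} F≗G G∈ = compose G∈ project λ fs xs →
    trans (F≗G fs xs) (cong (G fs) (sym (Vec.tabulate∘lookup xs)))

  Substitution : ℕ → ℕ → ℕ → Set
  Substitution k l m = Vec (Str → Str) k → Vec Str l → Vec Str m

  -- A record, so that T can be inferred from Inˢ T.
  record Inˢ (T : Substitution k l m) : Set where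
    constructor pointwise
    field
      component : ∀ j → In (λ fs xs → Vec.lookup (T fs xs) j)

  open Inˢ

  arguments-in : Inˢ {k} {l} (λ _ xs → xs)
  arguments-in = pointwise project

  substitute : ∀ {H : Functional k m} {T : Substitution k l m} →
    In H → Inˢ T → In (λ fs xs → H fs (T fs xs))
  substitute {H = H} {T} H∈ T∈ =
    compose H∈ (component T∈) λ fs xs → cong (H fs) (sym (Vec.tabulate∘lookup (T fs xs)))

  init-in : ∀ {T : Substitution k l (suc m)} → Inˢ T → Inˢ (λ fs xs → Vec.init (T fs xs))
  init-in {T = T} T∈ .component j =
    respects-≗ (λ fs xs → init-lookup (T fs xs) j) (component T∈ (inject₁ j))

  last-in : ∀ {T : Substitution k l (suc m)} → Inˢ T → In (λ fs xs → Vec.last (T fs xs))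
  last-in {T = T} T∈ = respects-≗ (λ fs xs → last-lookup (T fs xs)) (component T∈ (Fin.fromℕ _))

  tail-in : ∀ {T : Substitution k l (suc m)} → Inˢ T → Inˢ (λ fs xs → Vec.tail (T fs xs))
  tail-in {T = T} T∈ .component j =
    respects-≗ (λ fs xs → tail-lookup (T fs xs)) (component T∈ (suc j))

  ∷-in : ∀ {F : Functional k l} {T : Substitution k l m} →
    In F → Inˢ T → Inˢ (λ fs xs → F fs xs ∷ T fs xs)
  ∷-in F∈ T∈ .component zero    = F∈
  ∷-in F∈ T∈ .component (suc j) = component T∈ j

  -- `∷ʳ` reduces only on a matched vector, and `T fs xs` can be matched only pointwise; hence the
  -- detour through `respects-≗` in each case.
  ∷ʳ-in : ∀ {F : Functional k l} {T : Substitution k l m} →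
    Inˢ T → In F → Inˢ (λ fs xs → T fs xs ∷ʳ F fs xs)
  ∷ʳ-in {m = zero} {F} {T} T∈ F∈ .component zero = respects-≗ eq F∈
    where
    eq : ∀ fs xs → Vec.lookup (T fs xs ∷ʳ F fs xs) zero ≡ F fs xs
    eq fs xs with [] ← T fs xs = refl
  ∷ʳ-in {m = suc _} {F} {T} T∈ F∈ .component zero = respects-≗ eq (component T∈ zero)
    where
    eq : ∀ fs xs → Vec.lookup (T fs xs ∷ʳ F fs xs) zero ≡ Vec.lookup (T fs xs) zero
    eq fs xs with _ ∷ _ ← T fs xs = refl
  ∷ʳ-in {m = suc _} {F} {T} T∈ F∈ .component (suc j) =
    respects-≗ eq (component (∷ʳ-in (tail-in T∈) F∈) j)
    where
    eq : ∀ fs xs → Vec.lookup (T fs xs ∷ʳ F fs xs) (suc j) ≡ Vec.lookup (Vec.tail (T fs xs) ∷ʳ F fs xs) j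
    eq fs xs with _ ∷ _ ← T fs xs = refl

  []-in : Inˢ {k} {l} (λ _ _ → [])
  []-in .component ()

  select-in : ∀ {C A B : Functional k l} → In C → In A → In B →
    In (λ fs xs → select (C fs xs) (A fs xs) (B fs xs))
  select-in C∈ A∈ B∈ = substitute
    (lift-polyTime {F = λ _ ys → select (Vec.lookup ys 0F) (Vec.lookup ys 1F) (Vec.lookup ys 2F)}
      (select-polyTime 0F 1F 2F bit)
      (λ _ _ → sym (leadingBits-map-bit _)))
    (∷-in C∈ (∷-in A∈ (∷-in B∈ []-in)))

  nonemptyPrefixFlag-in : ∀ {U W : Functional k l} → In U → In W →
    In (λ fs xs → nonemptyPrefixFlag (U fs xs) (W fs xs))
  nonemptyPrefixFlag-in U∈ W∈ = substitute
    (lift-polyTime {F = λ _ ys → nonemptyPrefixFlag (Vec.head ys) (Vec.last ys)}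
      nonemptyPrefix-polyTime (λ _ _ → refl))
    (∷-in U∈ (∷-in W∈ []-in))

  1^-in : ∀ {F : Functional k l} → In F → In (λ fs xs → 1^ ∣ F fs xs ∣)
  1^-in F∈ = substitute
    (mapped-project (const (bit true)) 0F
      {F = λ _ ys → 1^ ∣ Vec.lookup ys 0F ∣}
      (λ _ ys → sym (leadingBits-map-true (Vec.lookup ys 0F))))
    (∷-in F∈ []-in)

  λ-in : In {k} {suc l} (λ _ _ → [])
  λ-in = mapped-project (const blank) 0F
    λ _ xs → sym (leadingBits-map-blank (Vec.lookup xs 0F))

  longestPrefixBelow-in : ∀ {W N : Functional k l} → In W → In N →
    In (λ fs xs → longestPrefixBelow (W fs xs) (num (N fs xs)))
  longestPrefixBelow-in W∈ N∈ = substitute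
    {H = λ _ ys → longestPrefixBelow (Vec.last (Vec.init ys)) (num (Vec.last ys))}
    (boundRec λ-in
      (select-in (nonemptyPrefixFlag-in n∈ w∈) n∈ (last-in arguments-in))
      (last-in arguments-in)
      record
        { base  = λ _ xs → cong (λ v → longestPrefixBelow (Vec.last (Vec.init (xs ∷ʳ []))) (num v)) (Vec.last-∷ʳ [] xs)
        ; step  = step
        ; bound = λ fs xs n → longestPrefixBelow-≤ (Vec.last (Vec.init (xs ∷ʳ str n))) (num (Vec.last (xs ∷ʳ str n)))
        })
    (∷-in W∈ (∷-in N∈ []-in))
    where
    -- The three arguments are `w`, the counter and the previous value, in this order.
    n∈ : In {_} {3} (λ _ ys → Vec.last (Vec.init ys))
    n∈ = last-in (init-in arguments-in)
    w∈ : In {_} {3} (λ _ ys → Vec.last (Vec.init (Vec.init ys)))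
    w∈ = last-in (init-in (init-in arguments-in))
    P : Vec Str 2 → Str
    P ys = longestPrefixBelow (Vec.last (Vec.init ys)) (num (Vec.last ys))
    step : ∀ (fs : Vec (Str → Str) _) (xs : Vec Str 1) n → P (xs ∷ʳ str (suc n)) ≡
      let ys = xs ∷ʳ str n ∷ʳ P (xs ∷ʳ str n) in
      select (nonemptyPrefixFlag (Vec.last (Vec.init ys)) (Vec.last (Vec.init (Vec.init ys))))
        (Vec.last (Vec.init ys)) (Vec.last ys)
    step fs (w ∷ []) n rewrite num-str (suc n) | num-str n = refl

  -- Limited recursion on notation by bounded recursion.

  limitedRecursion-in : ∀ {G : Functional k l} {H : Functional k (suc (suc l))}
    {K F : Functional k (suc l)} →
    In G → In H → In K → LimitedRecursionOnNotation G H K F → In F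
  limitedRecursion-in {k} {l} {G} {H} {K} {F} G∈ H∈ K∈ rec =
    respects-≗ F≡ (substitute Step∈ (∷ʳ-in (∷ʳ-in arguments-in (last-in arguments-in))
                         (substitute F′∈ (∷ʳ-in arguments-in (last-in arguments-in)))))
    where
    module rec = LimitedRecursionOnNotation rec

    -- The arguments are those of `F`, ending in `w`, followed by a counter: `w` stays fixed as a
    -- parameter while the counter runs.
    cut : Vec Str (suc (suc l)) → Vec Str (suc l)
    cut ys = Vec.init (Vec.init ys) ∷ʳ longestPrefixBelow (Vec.last (Vec.init ys)) (num (Vec.last ys))

    cut-∷ʳ : ∀ zs u → cut (zs ∷ʳ u) ≡ Vec.init zs ∷ʳ longestPrefixBelow (Vec.last zs) (num u)
    cut-∷ʳ zs u rewrite Vec.init-∷ʳ u zs | Vec.last-∷ʳ u zs = refl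

    cut∈ : Inˢ {k} (λ _ → cut)
    cut∈ = ∷ʳ-in (init-in (init-in arguments-in))
      (longestPrefixBelow-in (last-in (init-in arguments-in)) (last-in arguments-in))

    F′ : Functional k (suc (suc l))
    F′ fs ys = F fs (cut ys)

    advance : Vec (Str → Str) k → Vec Str l → (w u v : Str) → Str
    advance fs xs w u v = select (nonemptyPrefixFlag u w) (H fs (xs ∷ʳ u ∷ʳ v)) v

    Step : Functional k (suc (suc (suc l)))
    Step fs ys = advance fs (Vec.init zs) (Vec.last zs) (Vec.last (Vec.init ys)) (Vec.last ys)
      where zs = Vec.init (Vec.init ys)

    Step∈ : In Step
    Step∈ = select-in (nonemptyPrefixFlag-in u∈ (last-in zs∈))
      (substitute H∈ (∷ʳ-in (∷ʳ-in (init-in zs∈) u∈) (last-in arguments-in)))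
      (last-in arguments-in)
      where
      zs∈ : Inˢ {k} (λ _ ys → Vec.init (Vec.init ys))
      zs∈ = init-in (init-in arguments-in)
      u∈ : In {k} (λ _ ys → Vec.last (Vec.init ys))
      u∈ = last-in (init-in arguments-in)

    Step-∷ʳ : ∀ fs zs u v → Step fs (zs ∷ʳ u ∷ʳ v) ≡ advance fs (Vec.init zs) (Vec.last zs) u v
    Step-∷ʳ fs zs u v
      rewrite Vec.init-∷ʳ v (zs ∷ʳ u) | Vec.last-∷ʳ v (zs ∷ʳ u)
            | Vec.init-∷ʳ u zs | Vec.last-∷ʳ u zs = refl

    -- If `str n` is a nonempty prefix of `w`, the prefix carried so far is `str n` without its last
    -- symbol, so the step equation of `F` applies; otherwise nothing changes.
    advances : ∀ fs xs w n → F fs (xs ∷ʳ longestPrefixBelow w (suc n)) ≡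
      advance fs xs w (str n) (F fs (xs ∷ʳ longestPrefixBelow w n))
    advances fs xs w n with nonemptyPrefixFlag (str n) w in eq
    ... | []    = refl
    ... | _ ∷ _ with v , b , r , n≡ , refl ← nonemptyPrefixFlag-sound (str n) w eq = begin
      F fs (xs ∷ʳ str n)                             ≡⟨ cong (λ u → F fs (xs ∷ʳ u)) n≡ ⟩
      F fs (xs ∷ʳ (v List.∷ʳ b))                     ≡⟨ rec.step fs xs v b ⟩
      H fs (xs ∷ʳ (v List.∷ʳ b) ∷ʳ F fs (xs ∷ʳ v))   ≡⟨ cong₂ (λ u p → H fs (xs ∷ʳ u ∷ʳ F fs (xs ∷ʳ p))) (sym n≡) (sym parent) ⟩
      H fs (xs ∷ʳ str n ∷ʳ F fs (xs ∷ʳ longestPrefixBelow (str n List.++ r) n)) ∎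
      where
      open ≡-Reasoning
      n≡num : n ≡ num (v List.∷ʳ b)
      n≡num = trans (sym (num-str n)) (cong num n≡)
      parent : longestPrefixBelow (str n List.++ r) n ≡ v
      parent = trans (cong (λ u → longestPrefixBelow (u List.++ r) n) n≡)
        (longestPrefixBelow-parent v b r n
          (subst (num v ℕ.<_) (sym n≡num) (num-∷ʳ v b)) (ℕ.≤-reflexive n≡num))

    F′-∷ʳ : ∀ fs zs n → F′ fs (zs ∷ʳ str n) ≡ F fs (Vec.init zs ∷ʳ longestPrefixBelow (Vec.last zs) n)
    F′-∷ʳ fs zs n = trans (cong (F fs) (cut-∷ʳ zs (str n)))
      (cong (λ j → F fs (Vec.init zs ∷ʳ longestPrefixBelow (Vec.last zs) j)) (num-str n))

    F′∈ : In F′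
    F′∈ = boundRec
      -- At counter 0 the carried prefix is empty, where `F` equals `G`; `init` drops the parameter
      -- `w`.
      (substitute G∈ (init-in arguments-in))
      Step∈
      (1^-in (substitute K∈ cut∈))
      record
        { base  = λ fs zs → trans (F′-∷ʳ fs zs 0) (rec.base fs (Vec.init zs))
        ; step  = λ fs zs n → begin
            F′ fs (zs ∷ʳ str (suc n))
              ≡⟨ F′-∷ʳ fs zs (suc n) ⟩
            F fs (Vec.init zs ∷ʳ longestPrefixBelow (Vec.last zs) (suc n))
              ≡⟨ advances fs (Vec.init zs) (Vec.last zs) n ⟩
            advance fs (Vec.init zs) (Vec.last zs) (str n) (F fs (Vec.init zs ∷ʳ longestPrefixBelow (Vec.last zs) n))
              ≡⟨ cong (advance fs (Vec.init zs) (Vec.last zs) (str n)) (F′-∷ʳ fs zs n) ⟨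
            advance fs (Vec.init zs) (Vec.last zs) (str n) (F′ fs (zs ∷ʳ str n))
              ≡⟨ Step-∷ʳ fs zs (str n) (F′ fs (zs ∷ʳ str n)) ⟨
            Step fs (zs ∷ʳ str n ∷ʳ F′ fs (zs ∷ʳ str n))
              ∎
        ; bound = λ fs zs n → ≤ˢ-1^ (F′ fs (zs ∷ʳ str n)) (rec.bound fs _ _)
        }
      where open ≡-Reasoning

    -- As the bound is exclusive, a counter at `w` stops just before `w` itself; the extra `Step`
    -- makes up for this without computing a successor string. For empty `w` it changes nothing.
    F≡ : ∀ fs zs → F fs zs ≡ Step fs (zs ∷ʳ Vec.last zs ∷ʳ F′ fs (zs ∷ʳ Vec.last zs))
    F≡ fs zs = begin
      F fs zs
        ≡⟨ cong (F fs) (init∷ʳlast zs) ⟨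
      F fs (xs ∷ʳ w)
        ≡⟨ cong (λ u → F fs (xs ∷ʳ u)) (longestPrefixBelow-self w) ⟨
      F fs (xs ∷ʳ longestPrefixBelow w (suc (num w)))
        ≡⟨ advances fs xs w (num w) ⟩
      advance fs xs w (str (num w)) (F fs (xs ∷ʳ longestPrefixBelow w (num w)))
        ≡⟨ cong₂ (advance fs xs w) (str-num w) (cong (F fs) (sym (cut-∷ʳ zs w))) ⟩
      advance fs xs w w (F′ fs (zs ∷ʳ w))
        ≡⟨ Step-∷ʳ fs zs w (F′ fs (zs ∷ʳ w)) ⟨
      Step fs (zs ∷ʳ w ∷ʳ F′ fs (zs ∷ʳ w))
        ∎
      where
      open ≡-Reasoning
      xs = Vec.init zs
      w  = Vec.last zs

  -- The inclusion of classes and the theorem.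

  BFF⊆BFSF : ∀ {F : Functional k l} → BFF (BFSF g X) k l F → In F
  BFF⊆BFSF (contains G∈ F≗G)      = respects-≗ F≗G G∈
  BFF⊆BFSF (polyTime p)           = polyTime p
  BFF⊆BFSF (Ap eq)                = Ap eq
  BFF⊆BFSF (compose H∈ G∈ eq)     = compose (BFF⊆BFSF H∈) (λ j → BFF⊆BFSF (G∈ j)) eq
  BFF⊆BFSF (expand G∈ eq)         = expand (BFF⊆BFSF G∈) eq
  BFF⊆BFSF (limRec G∈ H∈ K∈ rec)  =
    limitedRecursion-in (BFF⊆BFSF G∈) (BFF⊆BFSF H∈) (BFF⊆BFSF K∈) rec

theorem6 : (i : ℕ) → .{{_ : NonZero i}} → (g : GrowthRate i) → IsResourceBound (pSpace g)
theorem6 i g k l = Closure.BFF⊆BFSF , λ F∈ → contains F∈ λ _ _ → refl
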